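{- For every integer $n>1$, the map $\Phi$ is a bijection between well-labelled Motzkin paths of size $n$ and labelled binary trees with $n$ leaves.
   Context: A well-labelled path of size $n$ is a pair $(\mathbf{p},\sigma)$ with $\mathbf{p}=p_1\ldots p_{n-1}$ a word on $\{ -1,0,+1\}$ and $\sigma$ a permutation of $[n]$ such that $p_i=-1\Rightarrow\sigma_i<\sigma_{i+1}$ and $p_i=1\Rightarrow\sigma_i>\sigma_{i+1}$; it is Motzkin if $\sum_{i=1}^jp_i\ge0$ for $j=1,\ldots,n-2$ and $\sum_{i=1}^{n-1}p_i=-1$. A labelled binary tree of size $n$ is a rooted tree with $n$ leaves carrying distinct labels in $[n]$, each unlabelled internal vertex having exactly two unordered children. For a set $I$ of $m$ integers, $\lambda_I$ is the order-preserving bijection $[m]\to I$; for a bijection $\lambda$ and a tree $\tau$, $\lambda(\tau)$ replaces each leaf label $i$ by $\lambda(i)$. The map $\Phi$ is defined recursively on a Motzkin path $(\mathbf{p},\sigma)$ of size $n\ge2$: (i) if $n=2$ (so $\mathbf{p}=(-1)$, $\sigma=12$), $\Phi(\mathbf{p},\sigma)$ is the tree with a root and two leaves labelled $1,2$. (ii) If $n>2$ and $p_1=0$, let $\mathbf{p}'=p_2\ldots p_{n-1}$ and $\sigma'_i=\lambda^{ -1}_{[n]\setminus\{\sigma_1\}}(\sigma_{i+1})$ for $i=1,\ldots,n-1$; then $\Phi(\mathbf{p},\sigma)$ is the tree consisting of a root whose two subtrees are a leaf labelled $\sigma_1$ and $\lambda_{[n]\setminus\{\sigma_1\}}(\Phi(\mathbf{p}',\sigma'))$.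 (iii) If $n>2$ and $p_1=1$, let $k$ be the least integer with $\sum_{i=1}^kp_i=0$, let $I'=\{\sigma_1,\ldots,\sigma_k\}$, $I''=\{\sigma_{k+1},\ldots,\sigma_n\}$, $p'_i=-p_{k-i}$ ($1\le i\le k-1$), $p''_i=p_{k+i}$ ($1\le i\le n-k-1$), $\sigma'_i=\lambda^{ -1}_{I'}(\sigma_{k+1-i})$ ($1\le i\le k$), $\sigma''_i=\lambda^{ -1}_{I''}(\sigma_{k+i})$ ($1\le i\le n-k$); then $\Phi(\mathbf{p},\sigma)$ is the tree consisting of a root whose two subtrees are $\lambda_{I'}(\Phi(\mathbf{p}',\sigma'))$ and $\lambda_{I''}(\Phi(\mathbf{p}'',\sigma''))$. -}

module Defs where

open import Data.Nat.Base using (ℕ; zero; suc; pred; _∸_; _≤_; _<_; z≤n; s≤s)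
import Data.Nat.Base as ℕ
import Data.Nat.Properties as ℕₚ
open import Data.Nat.Induction using (Acc; acc; <-wellFounded)
open import Data.Integer.Base using (ℤ; 0ℤ; 1ℤ; -1ℤ; -_; _+_; _-_)
import Data.Integer.Base as ℤ
import Data.Integer.Properties as ℤₚ
open import Data.Fin.Base using (Fin; zero; suc; toℕ; fromℕ<; inject₁; opposite; cast; splitAt; _↑ˡ_; _↑ʳ_)
import Data.Fin.Base as Fin
import Data.Fin.Properties as Finₚ
open import Data.Fin.Permutation using (Permutation; Permutation′; permutation; _⟨$⟩ʳ_; _⟨$⟩ˡ_; _∘ₚ_; cast-id; ↔⇒≡; inverseˡ; inverseʳ)
import Data.Fin.Permutation as Perm
open import Data.Fin.Subset using (Subset; inside; outside; _∈_; _∉_; ∣_∣; ∁; ⁅_⁆)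
open import Data.Fin.Subset.Properties using (x∈⁅x⁆; x∈⁅y⁆⇒x≡y; x∈∁p⇒x∉p; x∉p⇒x∈∁p)
open import Data.Vec.Base using (_∷_; here; there; tabulate)
open import Data.Vec.Properties using ([]=⇒lookup; lookup⇒[]=; lookup∘tabulate)
open import Data.Vec.Functional using (Vector)
open import Data.List.Base using (List; [_]; _++_; length)
import Data.List.Base as List
import Data.List.Properties as Listₚ
open import Data.List.Membership.Propositional using () renaming (_∈_ to _∈ˡ_)
open import Data.List.Membership.Propositional.Properties using (∈-map⁻)
open import Data.List.Relation.Unary.All using ([])
open import Data.List.Relation.Unary.Any using (here)
open import Data.List.Relation.Unary.AllPairs using ([]; _∷_)
open import Data.List.Relation.Unary.Unique.Propositional using (Unique)
import Data.List.Relation.Unary.Unique.Propositional.Properties as Uniqueₚ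
open import Data.List.Relation.Binary.Disjoint.Propositional using (Disjoint)
open import Data.Product.Base using (∃; ∃₂; _×_; _,_; proj₁; proj₂)
open import Data.Sum.Base using (inj₁; inj₂)
open import Function.Base using (_∘_)
open import Function.Definitions using (Injective)
open import Relation.Nullary using (does; yes; no; contradiction)
open import Relation.Nullary.Decidable using (dec-true)
open import Relation.Binary.Core using (Rel)
open import Relation.Binary.Structures using (IsEquivalence)
open import Relation.Binary.PropositionalEquality using (_≡_; _≢_; _≗_; refl; sym; trans; cong; cong₂; subst; subst₂; module ≡-Reasoning)
open import Level using (0ℓ)

private
  variable
    m n : ℕ

-- Conventions: the set [n] is Fin n, so labels and indices are shifted down
-- by one; permutations are read as words through σ ⟨$⟩ʳ_.

data Step : Set where
  -1ₛ 0ₛ +1ₛ : Step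

⟦_⟧ : Step → ℤ
⟦ -1ₛ ⟧ = -1ℤ
⟦ 0ₛ  ⟧ = 0ℤ
⟦ +1ₛ ⟧ = 1ℤ

neg : Step → Step
neg -1ₛ = +1ₛ
neg 0ₛ  = 0ₛ
neg +1ₛ = -1ₛ

-- height p j is p₁ + … + pⱼ, for j at most the length of p.
height : Vector Step n → ℕ → ℤ
height             p zero    = 0ℤ
height {n = zero}  p (suc j) = 0ℤ
height {n = suc n} p (suc j) = ⟦ p zero ⟧ + height (p ∘ suc) j

-- The two ends, i and i + 1, of the i-th step of a path of size n.
source target : Fin (pred n) → Fin n
source {n = suc n} = inject₁
target {n = suc n} = suc

record WellLabelledPath (n : ℕ) : Set where
  field
    p       : Vector Step (pred n)
    σ       : Permutation′ n
    ascent  : ∀ i → p i ≡ -1ₛ → σ ⟨$⟩ʳ source i Fin.< σ ⟨$⟩ʳ target i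
    descent : ∀ i → p i ≡ +1ₛ → σ ⟨$⟩ʳ source i Fin.> σ ⟨$⟩ʳ target i

record MotzkinPath (n : ℕ) : Set where
  field
    path   : WellLabelledPath n
  open WellLabelledPath path public
  field
    nonneg : ∀ j → 1 ≤ j → j ≤ n ∸ 2 → 0ℤ ℤ.≤ height p j
    total  : height p (n ∸ 1) ≡ -1ℤ

infix 4 _≈_

_≈_ : Rel (MotzkinPath n) 0ℓ
P ≈ Q = (P.p ≗ Q.p) × (P.σ Perm.≈ Q.σ)
  where
  module P = MotzkinPath P
  module Q = MotzkinPath Q

≈-isEquivalence : IsEquivalence (_≈_ {n})
≈-isEquivalence = record
  { refl  = (λ _ → refl) , (λ _ → refl)
  ; sym   = λ (e , f) → (λ i → sym (e i)) , (λ i → sym (f i))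
  ; trans = λ (e , f) (g , h) → (λ i → trans (e i) (g i)) , (λ i → trans (f i) (h i))
  }

data BinTree (A : Set) : Set where
  leaf : A → BinTree A
  node : BinTree A → BinTree A → BinTree A

leaves : ∀ {A} → BinTree A → List A
leaves (leaf x)   = [ x ]
leaves (node t u) = leaves t ++ leaves u

relabel : ∀ {A B} → (A → B) → BinTree A → BinTree B
relabel f (leaf x)   = leaf (f x)
relabel f (node t u) = node (relabel f t) (relabel f u)

infix 4 _≅_

-- Children are unordered: plane trees are identified when one is obtained
-- from the other by exchanging the two children of some internal vertices.
data _≅_ {A : Set} : Rel (BinTree A) 0ℓ where
  leaf : ∀ {x} → leaf x ≅ leaf x
  node : ∀ {t u t′ u′} → t ≅ t′ → u ≅ u′ → node t u ≅ node t′ u′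
  swap : ∀ {t u t′ u′} → t ≅ u′ → u ≅ t′ → node t u ≅ node t′ u′

record HasDistinctLeaves (m : ℕ) {n : ℕ} (t : BinTree (Fin n)) : Set where
  field
    size     : length (leaves t) ≡ m
    distinct : Unique (leaves t)

record LabelledBinaryTree (n : ℕ) : Set where
  field
    tree       : BinTree (Fin n)
    isLabelled : HasDistinctLeaves n tree

infix 4 _≈ᵗ_

_≈ᵗ_ : Rel (LabelledBinaryTree n) 0ℓ
τ ≈ᵗ υ = LabelledBinaryTree.tree τ ≅ LabelledBinaryTree.tree υ

≅-refl : ∀ {A} {t : BinTree A} → t ≅ t
≅-refl {t = leaf x}   = leaf
≅-refl {t = node t u} = node ≅-refl ≅-refl

≅-sym : ∀ {A} {t u : BinTree A} → t ≅ u → u ≅ t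
≅-sym leaf       = leaf
≅-sym (node e f) = node (≅-sym e) (≅-sym f)
≅-sym (swap e f) = swap (≅-sym f) (≅-sym e)

≅-trans : ∀ {A} {t u v : BinTree A} → t ≅ u → u ≅ v → t ≅ v
≅-trans leaf       leaf       = leaf
≅-trans (node e f) (node g h) = node (≅-trans e g) (≅-trans f h)
≅-trans (node e f) (swap g h) = swap (≅-trans e g) (≅-trans f h)
≅-trans (swap e f) (node g h) = swap (≅-trans e h) (≅-trans f g)
≅-trans (swap e f) (swap g h) = node (≅-trans e h) (≅-trans f g)

≈ᵗ-isEquivalence : IsEquivalence (_≈ᵗ_ {n})
≈ᵗ-isEquivalence = record { refl = ≅-refl ; sym = ≅-sym ; trans = ≅-trans }

-- The order-preserving bijection λ_I from [∣ I ∣] to I, and its inverse.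
λ⟨_⟩ : (I : Subset n) → Fin ∣ I ∣ → Fin n
λ⟨ inside  ∷ I ⟩ zero    = zero
λ⟨ inside  ∷ I ⟩ (suc j) = suc (λ⟨ I ⟩ j)
λ⟨ outside ∷ I ⟩ j       = suc (λ⟨ I ⟩ j)

λ⁻¹⟨_⟩ : (I : Subset n) {x : Fin n} → x ∈ I → Fin ∣ I ∣
λ⁻¹⟨ inside  ∷ I ⟩ here        = zero
λ⁻¹⟨ inside  ∷ I ⟩ (there x∈I) = suc (λ⁻¹⟨ I ⟩ x∈I)
λ⁻¹⟨ outside ∷ I ⟩ (there x∈I) = λ⁻¹⟨ I ⟩ x∈I

λ-∈ : (I : Subset n) (j : Fin ∣ I ∣) → λ⟨ I ⟩ j ∈ I
λ-∈ (inside  ∷ I) zero    = here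
λ-∈ (inside  ∷ I) (suc j) = there (λ-∈ I j)
λ-∈ (outside ∷ I) j       = there (λ-∈ I j)

λ-injective : (I : Subset n) → Injective _≡_ _≡_ λ⟨ I ⟩
λ-injective (inside  ∷ I) {zero}  {zero}  _  = refl
λ-injective (inside  ∷ I) {suc i} {suc j} eq = cong suc (λ-injective I (Finₚ.suc-injective eq))
λ-injective (outside ∷ I)                 eq = λ-injective I (Finₚ.suc-injective eq)

λ-λ⁻¹ : (I : Subset n) {x : Fin n} (x∈I : x ∈ I) → λ⟨ I ⟩ (λ⁻¹⟨ I ⟩ x∈I) ≡ x
λ-λ⁻¹ (inside  ∷ I) here        = refl
λ-λ⁻¹ (inside  ∷ I) (there x∈I) = cong suc (λ-λ⁻¹ I x∈I)
λ-λ⁻¹ (outside ∷ I) (there x∈I) = cong suc (λ-λ⁻¹ I x∈I)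

λ⁻¹-mono : (I : Subset n) {x y : Fin n} (x∈I : x ∈ I) (y∈I : y ∈ I) →
           x Fin.< y → λ⁻¹⟨ I ⟩ x∈I Fin.< λ⁻¹⟨ I ⟩ y∈I
λ⁻¹-mono (inside  ∷ I) here        (there y∈I) _         = s≤s z≤n
λ⁻¹-mono (inside  ∷ I) (there x∈I) (there y∈I) (s≤s x<y) = s≤s (λ⁻¹-mono I x∈I y∈I x<y)
λ⁻¹-mono (outside ∷ I) (there x∈I) (there y∈I) (s≤s x<y) = λ⁻¹-mono I x∈I y∈I x<y

-- The word f₁ … fₘ lists every element of I exactly once.
record _Lists_ {m n} (f : Fin m → Fin n) (I : Subset n) : Set where
  field
    injective : Injective _≡_ _≡_ f
    member    : ∀ i → f i ∈ I
    index     : ∀ {x} → x ∈ I → ∃ λ i → f i ≡ x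

module Listing {m n} {f : Fin m → Fin n} {I : Subset n} (L : f Lists I) where
  open _Lists_ L

  ranks : Permutation m ∣ I ∣
  ranks = permutation to from to-from from-to
    where
    to : Fin m → Fin ∣ I ∣
    to i = λ⁻¹⟨ I ⟩ (member i)
    from : Fin ∣ I ∣ → Fin m
    from j = proj₁ (index (λ-∈ I j))
    to-from : ∀ j → to (from j) ≡ j
    to-from j = λ-injective I (trans (λ-λ⁻¹ I (member (from j))) (proj₂ (index (λ-∈ I j))))
    from-to : ∀ i → from (to i) ≡ i
    from-to i = injective (trans (proj₂ (index (λ-∈ I (to i)))) (λ-λ⁻¹ I (member i)))

  -- The permutation i ↦ λ_I⁻¹(fᵢ) of [m].
  standardise : Permutation′ m
  standardise = ranks ∘ₚ cast-id (sym (↔⇒≡ ranks))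

  -- λ_I as a map out of [m]; ∣ I ∣ and m agree only propositionally.
  embed : Fin m → Fin n
  embed j = λ⟨ I ⟩ (cast (↔⇒≡ ranks) j)

  standardise-mono : ∀ {i j} → f i Fin.< f j → standardise ⟨$⟩ʳ i Fin.< standardise ⟨$⟩ʳ j
  standardise-mono {i} {j} fi<fj = subst₂ _<_
    (sym (Finₚ.toℕ-cast (sym (↔⇒≡ ranks)) _)) (sym (Finₚ.toℕ-cast (sym (↔⇒≡ ranks)) _))
    (λ⁻¹-mono I (member i) (member j) fi<fj)

  embed-∈ : ∀ j → embed j ∈ I
  embed-∈ j = λ-∈ I _

  embed-injective : Injective _≡_ _≡_ embed
  embed-injective eq = cast-injective (λ-injective I eq)
    where
    cast-injective : ∀ {i j} → cast (↔⇒≡ ranks) i ≡ cast (↔⇒≡ ranks) j → i ≡ j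
    cast-injective {i} {j} e = Finₚ.toℕ-injective
      (trans (sym (Finₚ.toℕ-cast (↔⇒≡ ranks) i))
        (trans (cong toℕ e) (Finₚ.toℕ-cast (↔⇒≡ ranks) j)))

image : (Fin m → Fin n) → Subset n
image f = tabulate λ x → does (Finₚ.any? λ i → f i Finₚ.≟ x)

∈-image⁺ : (f : Fin m → Fin n) (i : Fin m) → f i ∈ image f
∈-image⁺ f i = lookup⇒[]= (f i) (image f)
  (trans (lookup∘tabulate _ (f i)) (dec-true (Finₚ.any? λ j → f j Finₚ.≟ f i) (i , refl)))

∈-image⁻ : (f : Fin m → Fin n) {x : Fin n} → x ∈ image f → ∃ λ i → f i ≡ x
∈-image⁻ f {x} x∈ with Finₚ.any? (λ i → f i Finₚ.≟ x) | trans (sym (lookup∘tabulate (λ x → does (Finₚ.any? λ i → f i Finₚ.≟ x)) x)) ([]=⇒lookup x∈)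
... | yes found | _  = found
... | no  _     | ()

height-suc : (p : Vector Step n) (i : Fin n) →
             height p (suc (toℕ i)) ≡ height p (toℕ i) + ⟦ p i ⟧
height-suc {n = suc n} p zero    = ℤₚ.+-comm ⟦ p zero ⟧ 0ℤ
height-suc {n = suc n} p (suc i) = trans
  (cong (⟦ p zero ⟧ +_) (height-suc (p ∘ suc) i))
  (sym (ℤₚ.+-assoc ⟦ p zero ⟧ (height (p ∘ suc) (toℕ i)) ⟦ p (suc i) ⟧))

height-drop : ∀ m {l} (p : Vector Step (m ℕ.+ l)) j →
              height p (m ℕ.+ j) ≡ height p m + height (p ∘ (m ↑ʳ_)) j
height-drop zero    p j = sym (ℤₚ.+-identityˡ (height p j))
height-drop (suc m) p j = trans
  (cong (⟦ p zero ⟧ +_) (height-drop m (p ∘ suc) j))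
  (sym (ℤₚ.+-assoc ⟦ p zero ⟧ (height (p ∘ suc) m) (height (p ∘ suc ∘ (m ↑ʳ_)) j)))

⟦neg⟧ : ∀ s → ⟦ neg s ⟧ ≡ - ⟦ s ⟧
⟦neg⟧ -1ₛ = refl
⟦neg⟧ 0ₛ  = refl
⟦neg⟧ +1ₛ = refl

height-take : ∀ m {l} (p : Vector Step (m ℕ.+ l)) j → j ≤ m →
              height (λ i → p (i ↑ˡ l)) j ≡ height p j
height-take m       p zero    _         = refl
height-take (suc m) p (suc j) (s≤s j≤m) = cong (⟦ p zero ⟧ +_) (height-take m (p ∘ suc) j j≤m)

height-reverse : (q : Vector Step m) (j : ℕ) → j ≤ m →
                 height (neg ∘ q ∘ opposite) j + height q m ≡ height q (m ∸ j)
height-reverse {m} q zero    _   = ℤₚ.+-identityˡ (height q m)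
height-reverse {m} q (suc j) j<m = begin
  height r (suc j) + H              ≡⟨ cong (λ k → height r (suc k) + H) (sym toℕi) ⟩
  height r (suc (toℕ i)) + H        ≡⟨ cong (_+ H) (height-suc r i) ⟩
  height r (toℕ i) + ⟦ r i ⟧ + H    ≡⟨ cong₂ (λ k s → height r k + s + H) toℕi (⟦neg⟧ (q i′)) ⟩
  height r j + - s + H              ≡⟨ ℤₚ.+-assoc (height r j) (- s) H ⟩
  height r j + (- s + H)            ≡⟨ cong (height r j +_) (ℤₚ.+-comm (- s) H) ⟩
  height r j + (H + - s)            ≡⟨ ℤₚ.+-assoc (height r j) H (- s) ⟨
  height r j + H + - s              ≡⟨ cong (_+ - s) (height-reverse q j (ℕₚ.<⇒≤ j<m)) ⟩
  height q (m ∸ j) + - s            ≡⟨ cong (λ k → height q k + - s) (sym suc-i′) ⟩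
  height q (suc (toℕ i′)) + - s     ≡⟨ cong (_+ - s) (height-suc q i′) ⟩
  height q (toℕ i′) + s + - s       ≡⟨ ℤₚ.+-assoc (height q (toℕ i′)) s (- s) ⟩
  height q (toℕ i′) + (s + - s)     ≡⟨ cong (λ z → height q (toℕ i′) + z) (ℤₚ.+-inverseʳ s) ⟩
  height q (toℕ i′) + 0ℤ            ≡⟨ ℤₚ.+-identityʳ _ ⟩
  height q (toℕ i′)                 ≡⟨ cong (height q) toℕi′ ⟩
  height q (m ∸ suc j)              ∎
  where
  open ≡-Reasoning
  r = neg ∘ q ∘ opposite
  H = height q m
  i = fromℕ< j<m
  i′ = opposite i
  s = ⟦ q i′ ⟧
  toℕi : toℕ i ≡ j
  toℕi = Finₚ.toℕ-fromℕ< j<m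
  toℕi′ : toℕ i′ ≡ m ∸ suc j
  toℕi′ = trans (Finₚ.opposite-prop i) (cong (λ k → m ∸ suc k) toℕi)
  suc-i′ : suc (toℕ i′) ≡ m ∸ j
  suc-i′ = trans (cong suc toℕi′) (sym (ℕₚ.+-∸-assoc 1 j<m))

record IsFirstReturn (p : Vector Step n) (k : ℕ) : Set where
  field
    positive : 1 ≤ k
    return   : height p k ≡ 0ℤ
    least    : ∀ j → 1 ≤ j → j < k → height p j ≢ 0ℤ

-- In the last case k = 2 + a and n - k = 2 + b; both are always at least 2.
data View : MotzkinPath n → Set where
  size-2  : (P : MotzkinPath 2) → View P
  start-0 : (P : MotzkinPath (3 ℕ.+ m)) → MotzkinPath.p P zero ≡ 0ₛ → View P
  start-1 : ∀ a b (P : MotzkinPath ((2 ℕ.+ a) ℕ.+ (2 ℕ.+ b))) → MotzkinPath.p P zero ≡ +1ₛ →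
            IsFirstReturn (MotzkinPath.p P) (2 ℕ.+ a) → View P

hitsZero : (q : Vector Step m) (h : ℕ) → ℤ.+ suc h + height q m ≡ -1ℤ →
  ∃₂ λ a b → m ≡ a ℕ.+ (2 ℕ.+ b) × (ℤ.+ suc h + height q (suc a) ≡ 0ℤ) ×
             (∀ j → j ≤ a → ℤ.+ suc h + height q j ≢ 0ℤ)
hitsZero {zero}  q h ()
hitsZero {suc m} q h eq = go (q zero) refl h eq
  where
  r = q ∘ suc
  shift : ∀ h h′ s → ℤ.+ h + ⟦ s ⟧ ≡ ℤ.+ h′ → ∀ x → ℤ.+ h + (⟦ s ⟧ + x) ≡ ℤ.+ h′ + x
  shift h h′ s e x = trans (sym (ℤₚ.+-assoc (ℤ.+ h) ⟦ s ⟧ x)) (cong (_+ x) e)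
  recurse : ∀ h h′ → ℤ.+ suc h + ⟦ q zero ⟧ ≡ ℤ.+ suc h′ → ℤ.+ suc h + height q (suc m) ≡ -1ℤ →
    ∃₂ λ a b → suc m ≡ a ℕ.+ (2 ℕ.+ b) × (ℤ.+ suc h + height q (suc a) ≡ 0ℤ) ×
               (∀ j → j ≤ a → ℤ.+ suc h + height q j ≢ 0ℤ)
  recurse h h′ e tot
    with a , b , m≡ , ret , lst ← hitsZero r h′ (trans (sym (shift (suc h) (suc h′) (q zero) e _)) tot)
    = suc a , b , cong suc m≡ , trans (shift (suc h) (suc h′) (q zero) e _) ret ,
      λ { zero    _         → λ ()
        ; (suc j) (s≤s j≤a) → λ z → lst j j≤a (trans (sym (shift (suc h) (suc h′) (q zero) e _)) z) }
  go : ∀ s → q zero ≡ s → ∀ h → ℤ.+ suc h + height q (suc m) ≡ -1ℤ →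
    ∃₂ λ a b → suc m ≡ a ℕ.+ (2 ℕ.+ b) × (ℤ.+ suc h + height q (suc a) ≡ 0ℤ) ×
               (∀ j → j ≤ a → ℤ.+ suc h + height q j ≢ 0ℤ)
  go 0ₛ  e h       tot = recurse h h (trans (cong (λ s → ℤ.+ suc h + ⟦ s ⟧) e) (ℤₚ.+-identityʳ _)) tot
  go +1ₛ e h       tot = recurse h (suc h)
    (trans (cong (λ s → ℤ.+ suc h + ⟦ s ⟧) e) (cong ℤ.+_ (ℕₚ.+-comm (suc h) 1))) tot
  go -1ₛ e (suc h) tot = recurse (suc h) h (cong (λ s → ℤ.+ suc (suc h) + ⟦ s ⟧) e) tot
  go -1ₛ e zero    tot = 0 , last m r (trans (sym (shift 1 0 (q zero) step _)) tot)
    where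
    step : 1ℤ + ⟦ q zero ⟧ ≡ 0ℤ
    step = cong (λ s → 1ℤ + ⟦ s ⟧) e
    last : ∀ m (r : Vector Step m) → 0ℤ + height r m ≡ -1ℤ →
      ∃ λ b → suc m ≡ 2 ℕ.+ b × (1ℤ + height q 1 ≡ 0ℤ) × (∀ j → j ≤ 0 → 1ℤ + height q j ≢ 0ℤ)
    last zero    r ()
    last (suc b) r _ = b , refl , trans (cong (λ z → 1ℤ + z) (ℤₚ.+-identityʳ ⟦ q zero ⟧)) step ,
      λ { zero _ () }

view : (P : MotzkinPath (2 ℕ.+ m)) → View P
view P = go P (MotzkinPath.p P zero) refl
  where
  go : (P : MotzkinPath (2 ℕ.+ m)) → ∀ s → MotzkinPath.p P zero ≡ s → View P
  go {zero}  P 0ₛ  e = size-2 P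
  go {suc m} P 0ₛ  e = start-0 P e
  go {zero}  P -1ₛ e = size-2 P
  go {suc m} P -1ₛ e =
    contradiction (subst (λ s → 0ℤ ℤ.≤ ⟦ s ⟧ + 0ℤ) e (MotzkinPath.nonneg P 1 (s≤s z≤n) (s≤s z≤n))) λ ()
  go {m}     P +1ₛ e
    with a , b , refl , ret , lst ← hitsZero (MotzkinPath.p P ∘ suc) 0
           (trans (cong (λ s → ⟦ s ⟧ + height (MotzkinPath.p P ∘ suc) m) (sym e)) (MotzkinPath.total P))
    = start-1 a b P e record
        { positive = s≤s z≤n
        ; return   = trans (first (suc a)) ret
        ; least    = λ { (suc j) _ (s≤s (s≤s j≤a)) z → lst j j≤a (trans (sym (first j)) z) }
        }
    where
    first : ∀ j → height (MotzkinPath.p P) (suc j) ≡ 1ℤ + height (MotzkinPath.p P ∘ suc) j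
    first j = cong (λ s → ⟦ s ⟧ + height (MotzkinPath.p P ∘ suc) j) e

module Start-0 (P : MotzkinPath (3 ℕ.+ m)) (p₁≡0 : MotzkinPath.p P zero ≡ 0ₛ) where
  open MotzkinPath P

  σ₁ : Fin (3 ℕ.+ m)
  σ₁ = σ ⟨$⟩ʳ zero

  I : Subset (3 ℕ.+ m)
  I = ∁ ⁅ σ₁ ⁆

  σ-injective : Injective _≡_ _≡_ (σ ⟨$⟩ʳ_)
  σ-injective eq = trans (sym (inverseˡ σ)) (trans (cong (σ ⟨$⟩ˡ_) eq) (inverseˡ σ))

  listing : (λ i → σ ⟨$⟩ʳ suc i) Lists I
  listing = record
    { injective = λ eq → Finₚ.suc-injective (σ-injective eq)
    ; member    = λ i → x∉p⇒x∈∁p λ ∈₁ → contradiction (σ-injective (x∈⁅y⁆⇒x≡y σ₁ ∈₁)) λ ()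
    ; index     = λ {x} x∈I → index x (σ ⟨$⟩ˡ x) (inverseʳ σ) x∈I
    }
    where
    index : ∀ x i → σ ⟨$⟩ʳ i ≡ x → x ∈ I → ∃ λ i → σ ⟨$⟩ʳ suc i ≡ x
    index x zero    refl x∈I = contradiction (x∈⁅x⁆ x) (x∈∁p⇒x∉p x∈I)
    index x (suc i) eq   _   = i , eq

  open Listing listing public

  smaller : MotzkinPath (2 ℕ.+ m)
  smaller = record
    { path   = record
      { p       = λ i → p (suc i)
      ; σ       = standardise
      ; ascent  = λ i e → standardise-mono (ascent (suc i) e)
      ; descent = λ i e → standardise-mono (descent (suc i) e)
      }
    ; nonneg = λ j _ j≤m → subst (0ℤ ℤ.≤_) (rest j) (nonneg (suc j) (s≤s z≤n) (s≤s j≤m))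
    ; total  = trans (sym (rest (suc m))) total
    }
    where
    rest : ∀ j → height p (suc j) ≡ height (p ∘ suc) j
    rest j = trans (cong (λ s → ⟦ s ⟧ + height (p ∘ suc) j) p₁≡0) (ℤₚ.+-identityˡ _)

-- In zero-based indices, positions 1 … k of σ are i ↑ˡ l and positions
-- k + 1 … k + l are k ↑ʳ i; step k is suc a ↑ʳ zero.
module Start-1 (a b : ℕ) (P : MotzkinPath ((2 ℕ.+ a) ℕ.+ (2 ℕ.+ b)))
               (isFirstReturn : IsFirstReturn (MotzkinPath.p P) (2 ℕ.+ a)) where
  open MotzkinPath P
  open IsFirstReturn isFirstReturn

  k l : ℕ
  k = 2 ℕ.+ a
  l = 2 ℕ.+ b

  prefix : Fin k → Fin (k ℕ.+ l)
  prefix i = σ ⟨$⟩ʳ (i ↑ˡ l)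

  suffix : Fin l → Fin (k ℕ.+ l)
  suffix i = σ ⟨$⟩ʳ (k ↑ʳ i)

  I′ I″ : Subset (k ℕ.+ l)
  I′ = image prefix
  I″ = image suffix

  σ-injective : Injective _≡_ _≡_ (σ ⟨$⟩ʳ_)
  σ-injective eq = trans (sym (inverseˡ σ)) (trans (cong (σ ⟨$⟩ˡ_) eq) (inverseˡ σ))

  disjoint : ∀ {x} → x ∈ I′ → x ∉ I″
  disjoint x∈I′ x∈I″
    with i , refl ← ∈-image⁻ prefix x∈I′ | j , eq ← ∈-image⁻ suffix x∈I″
    = contradiction
        (trans (sym (Finₚ.splitAt-↑ʳ k l j)) (trans (cong (splitAt k) (σ-injective eq)) (Finₚ.splitAt-↑ˡ k i l)))
        λ ()

  -- opposite i is k + 1 - i in one-based numbering.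
  listing′ : (prefix ∘ opposite) Lists I′
  listing′ = record
    { injective = λ {i} {j} eq → trans (sym (Finₚ.opposite-involutive i))
        (trans (cong opposite (Finₚ.↑ˡ-injective l _ _ (σ-injective eq))) (Finₚ.opposite-involutive j))
    ; member    = λ i → ∈-image⁺ prefix (opposite i)
    ; index     = index
    }
    where
    index : ∀ {x} → x ∈ I′ → ∃ λ i → prefix (opposite i) ≡ x
    index x∈I′ with i , refl ← ∈-image⁻ prefix x∈I′ =
      opposite i , cong prefix (Finₚ.opposite-involutive i)

  listing″ : suffix Lists I″
  listing″ = record
    { injective = λ eq → Finₚ.↑ʳ-injective k _ _ (σ-injective eq)
    ; member    = ∈-image⁺ suffix
    ; index     = ∈-image⁻ suffix
    }

  module L′ = Listing listing′
  module L″ = Listing listing″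

  p′ : Vector Step (suc a)
  p′ i = neg (p (opposite i ↑ˡ l))

  p″ : Vector Step (suc b)
  p″ i = p (suc a ↑ʳ suc i)

  positive-below : ∀ j → 1 ≤ j → j < k → 1ℤ ℤ.≤ height p j
  positive-below j 1≤j j<k = ℤₚ.i<j⇒suc[i]≤j (ℤₚ.≤∧≢⇒< (nonneg j 1≤j bound) (least j 1≤j j<k ∘ sym))
    where
    bound : j ≤ a ℕ.+ l
    bound = ℕₚ.≤-trans (ℕₚ.≤-pred j<k) (ℕₚ.≤-trans (ℕₚ.m≤n+m (suc a) (suc b))
      (ℕₚ.≤-reflexive (trans (ℕₚ.+-comm (suc b) (suc a)) (sym (ℕₚ.+-suc a (suc b))))))

  iₖ : Fin (suc a ℕ.+ l)
  iₖ = suc a ↑ʳ zero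

  toℕ-iₖ : toℕ iₖ ≡ suc a
  toℕ-iₖ = trans (Finₚ.toℕ-↑ʳ (suc a) (zero {suc b})) (ℕₚ.+-identityʳ (suc a))

  before-return : height p (suc a) ≡ 1ℤ
  before-return = pin (p iₖ) (positive-below (suc a) (s≤s z≤n) ℕₚ.≤-refl)
    (trans (sym (subst (λ x → height p (suc x) ≡ height p x + ⟦ p iₖ ⟧) toℕ-iₖ (height-suc p iₖ))) return)
    where
    pin : ∀ {z} s → 1ℤ ℤ.≤ z → z + ⟦ s ⟧ ≡ 0ℤ → z ≡ 1ℤ
    pin {ℤ.+ 1}             -1ₛ _ _  = refl
    pin {ℤ.+ suc (suc _)}   -1ₛ _ ()
    pin {ℤ.+ suc _}         0ₛ  _ ()
    pin {ℤ.+ suc _}         +1ₛ _ ()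
    pin {ℤ.+ 0} s (ℤ.+≤+ ()) _

  height-p′ : ∀ j → j ≤ suc a → height p′ j + 1ℤ ≡ height p (suc a ∸ j)
  height-p′ j j≤ = begin
    height p′ j + 1ℤ               ≡⟨ cong (height p′ j +_) (trans (sym before-return) (sym (height-take (suc a) p (suc a) ℕₚ.≤-refl))) ⟩
    height p′ j + height q (suc a) ≡⟨ height-reverse q j j≤ ⟩
    height q (suc a ∸ j)           ≡⟨ height-take (suc a) p (suc a ∸ j) (ℕₚ.m∸n≤m (suc a) j) ⟩
    height p (suc a ∸ j)           ∎
    where
    open ≡-Reasoning
    q : Vector Step (suc a)
    q i = p (i ↑ˡ l)

  height-p″ : ∀ j → height p (k ℕ.+ j) ≡ height p″ j
  height-p″ j = begin
    height p (k ℕ.+ j)                                                ≡⟨ cong (height p) (sym (ℕₚ.+-suc (suc a) j)) ⟩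
    height p (suc a ℕ.+ suc j)                                        ≡⟨ height-drop (suc a) p (suc j) ⟩
    height p (suc a) + (⟦ p iₖ ⟧ + height p″ j)                       ≡⟨ ℤₚ.+-assoc (height p (suc a)) ⟦ p iₖ ⟧ (height p″ j) ⟨
    height p (suc a) + ⟦ p iₖ ⟧ + height p″ j                         ≡⟨ cong (λ x → height p x + ⟦ p iₖ ⟧ + height p″ j) toℕ-iₖ ⟨
    height p (toℕ iₖ) + ⟦ p iₖ ⟧ + height p″ j                        ≡⟨ cong (_+ height p″ j) (height-suc p iₖ) ⟨
    height p (suc (toℕ iₖ)) + height p″ j                             ≡⟨ cong (λ x → height p (suc x) + height p″ j) toℕ-iₖ ⟩
    height p k + height p″ j                                          ≡⟨ cong (_+ height p″ j) return ⟩
    0ℤ + height p″ j                                                  ≡⟨ ℤₚ.+-identityˡ _ ⟩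
    height p″ j                                                       ∎
    where open ≡-Reasoning

  neg≡-1 : ∀ s → neg s ≡ -1ₛ → s ≡ +1ₛ
  neg≡-1 +1ₛ _ = refl

  neg≡+1 : ∀ s → neg s ≡ +1ₛ → s ≡ -1ₛ
  neg≡+1 -1ₛ _ = refl

  opposite-inject₁ : ∀ {n} (i : Fin n) → opposite (inject₁ i) ≡ suc (opposite i)
  opposite-inject₁ zero    = refl
  opposite-inject₁ (suc i) = cong inject₁ (opposite-inject₁ i)

  inject₁-↑ˡ : ∀ {n} (i : Fin n) l → inject₁ (i ↑ˡ l) ≡ inject₁ i ↑ˡ l
  inject₁-↑ˡ zero    l = refl
  inject₁-↑ˡ (suc i) l = cong suc (inject₁-↑ˡ i l)

  inject₁-↑ʳ : ∀ m {n} (i : Fin n) → inject₁ (m ↑ʳ suc i) ≡ suc m ↑ʳ inject₁ i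
  inject₁-↑ʳ zero    i = refl
  inject₁-↑ʳ (suc m) i = cong suc (inject₁-↑ʳ m i)

  source′ : ∀ (i : Fin (suc a)) → suc (opposite i ↑ˡ l) ≡ opposite (inject₁ i) ↑ˡ l
  source′ i = cong (_↑ˡ l) (sym (opposite-inject₁ i))

  target′ : ∀ (i : Fin (suc a)) → inject₁ (opposite i ↑ˡ l) ≡ opposite (suc i) ↑ˡ l
  target′ i = inject₁-↑ˡ (opposite i) l

  smaller′ : MotzkinPath k
  smaller′ = record
    { path   = record
      { p       = p′
      ; σ       = L′.standardise
      ; ascent  = λ i e → L′.standardise-mono {inject₁ i} {suc i}
          (subst₂ (λ x y → σ ⟨$⟩ʳ x Fin.< σ ⟨$⟩ʳ y) (source′ i) (target′ i) (descent _ (neg≡-1 _ e)))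
      ; descent = λ i e → L′.standardise-mono {suc i} {inject₁ i}
          (subst₂ (λ x y → σ ⟨$⟩ʳ x Fin.< σ ⟨$⟩ʳ y) (target′ i) (source′ i) (ascent _ (neg≡+1 _ e)))
      }
    ; nonneg = λ j _ → nonneg′ j
    ; total  = trans (sym (cancel (suc a) ℕₚ.≤-refl)) (cong (λ j → height p j - 1ℤ) (ℕₚ.n∸n≡0 (suc a)))
    }
    where
    cancel : ∀ j → j ≤ suc a → height p (suc a ∸ j) - 1ℤ ≡ height p′ j
    cancel j j≤1+a = trans (cong (_- 1ℤ) (sym (height-p′ j j≤1+a)))
      (trans (ℤₚ.+-assoc (height p′ j) 1ℤ -1ℤ) (ℤₚ.+-identityʳ _))
    nonneg′ : ∀ j → j ≤ a → 0ℤ ℤ.≤ height p′ j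
    nonneg′ j j≤a = ℤₚ.≤-trans (ℤₚ.i≤j⇒0≤j-i above) (ℤₚ.≤-reflexive (cancel j (ℕₚ.m≤n⇒m≤1+n j≤a)))
      where
      above : 1ℤ ℤ.≤ height p (suc a ∸ j)
      above = positive-below (suc a ∸ j) (ℕₚ.m<n⇒0<n∸m (s≤s j≤a)) (s≤s (ℕₚ.m∸n≤m (suc a) j))


  smaller″ : MotzkinPath l
  smaller″ = record
    { path   = record
      { p       = p″
      ; σ       = L″.standardise
      ; ascent  = λ i e → L″.standardise-mono
          (subst (λ x → σ ⟨$⟩ʳ x Fin.< σ ⟨$⟩ʳ (k ↑ʳ suc i)) (inject₁-↑ʳ (suc a) i) (ascent _ e))
      ; descent = λ i e → L″.standardise-mono
          (subst (λ x → σ ⟨$⟩ʳ (k ↑ʳ suc i) Fin.< σ ⟨$⟩ʳ x) (inject₁-↑ʳ (suc a) i) (descent _ e))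
      }
    ; nonneg = λ j 1≤j j≤b → subst (0ℤ ℤ.≤_) (height-p″ j) (nonneg (k ℕ.+ j) (s≤s z≤n) (bound j j≤b))
    ; total  = trans (sym (height-p″ (suc b))) (trans (cong (height p) (sym (ℕₚ.+-suc (suc a) (suc b)))) total)
    }
    where
    bound : ∀ j → j ≤ b → k ℕ.+ j ≤ a ℕ.+ l
    bound j j≤b = ℕₚ.≤-trans (ℕₚ.+-monoʳ-≤ k j≤b)
      (ℕₚ.≤-reflexive (sym (trans (ℕₚ.+-suc a (suc b)) (cong suc (ℕₚ.+-suc a b)))))

leaves-relabel : ∀ {A B} (f : A → B) t → leaves (relabel f t) ≡ List.map f (leaves t)
leaves-relabel f (leaf x)   = refl
leaves-relabel f (node t u) = trans (cong₂ _++_ (leaves-relabel f t) (leaves-relabel f u))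
  (sym (Listₚ.map-++ f (leaves t) (leaves u)))

leaf-distinct : (x : Fin n) → HasDistinctLeaves 1 (leaf x)
leaf-distinct x = record { size = refl ; distinct = [] ∷ [] }

node-distinct : ∀ {m l n} {t u : BinTree (Fin n)} → HasDistinctLeaves m t → HasDistinctLeaves l u →
                Disjoint (leaves t) (leaves u) → HasDistinctLeaves (m ℕ.+ l) (node t u)
node-distinct {t = t} T U t#u = record
  { size     = trans (Listₚ.length-++ (leaves t)) (cong₂ ℕ._+_ T.size U.size)
  ; distinct = Uniqueₚ.++⁺ T.distinct U.distinct t#u
  }
  where
  module T = HasDistinctLeaves T
  module U = HasDistinctLeaves U

relabel-distinct : ∀ {l m n} {f : Fin m → Fin n} {t} → Injective _≡_ _≡_ f →
                   HasDistinctLeaves l t → HasDistinctLeaves l (relabel f t)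
relabel-distinct {f = f} {t} f-inj T = record
  { size     = trans (cong length (leaves-relabel f t)) (trans (Listₚ.length-map f (leaves t)) T.size)
  ; distinct = subst Unique (sym (leaves-relabel f t)) (Uniqueₚ.map⁺ f-inj T.distinct)
  }
  where module T = HasDistinctLeaves T

leaves-embed-∈ : ∀ {f : Fin m → Fin n} {I} (L : f Lists I) t {x} →
                 x ∈ˡ leaves (relabel (Listing.embed L) t) → x ∈ I
leaves-embed-∈ {I = I} L t x∈ with y , _ , eq ← ∈-map⁻ _ (subst (_ ∈ˡ_) (leaves-relabel _ t) x∈) =
  subst (_∈ I) (sym eq) (Listing.embed-∈ L y)

Φ-rec : Acc _<_ n → {P : MotzkinPath n} → View P → LabelledBinaryTree n
Φ-rec _ (size-2 P) = record
  { tree       = node (leaf zero) (leaf (suc zero))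
  ; isLabelled = node-distinct (leaf-distinct zero) (leaf-distinct (suc zero)) λ { (here refl , here ()) }
  }
Φ-rec (acc rec) (start-0 P p₁≡0) = record
  { tree       = node (leaf σ₁) (relabel embed τ.tree)
  ; isLabelled = node-distinct (leaf-distinct σ₁) (relabel-distinct embed-injective τ.isLabelled)
                   λ { (here refl , x∈) → x∈∁p⇒x∉p (leaves-embed-∈ listing τ.tree x∈) (x∈⁅x⁆ σ₁) }
  }
  where
  open Start-0 P p₁≡0
  module τ = LabelledBinaryTree (Φ-rec (rec (ℕₚ.n<1+n _)) (view smaller))
Φ-rec (acc rec) (start-1 a b P _ isFirstReturn) = record
  { tree       = node (relabel L′.embed τ′.tree) (relabel L″.embed τ″.tree)
  ; isLabelled = node-distinct (relabel-distinct L′.embed-injective τ′.isLabelled)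
                               (relabel-distinct L″.embed-injective τ″.isLabelled)
                   λ { (x∈′ , x∈″) → disjoint (leaves-embed-∈ listing′ τ′.tree x∈′) (leaves-embed-∈ listing″ τ″.tree x∈″) }
  }
  where
  open Start-1 a b P isFirstReturn
  module τ′ = LabelledBinaryTree (Φ-rec (rec (ℕₚ.m<m+n k (s≤s z≤n))) (view smaller′))
  module τ″ = LabelledBinaryTree (Φ-rec (rec (ℕₚ.m<n+m l {k} (s≤s z≤n))) (view smaller″))

Φ : 1 < n → MotzkinPath n → LabelledBinaryTree n
Φ (s≤s (s≤s _)) P = Φ-rec (<-wellFounded _) (view P)

{-# OPTIONS --safe #-}
-- Read a Motzkin path as a pair of words: its steps and its labels.  Two
-- words coding trees t and u with at least two leaves each are glued by
-- reversing the first, negating its steps, and inserting a step -1; the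
-- glued word is well labelled exactly when the first label of the word of t
-- is smaller than that of u.  So exactly one of the two orders of the children
-- is admissible, which makes the coding of unordered trees by words total and
-- functional.  Conversely the inserted step is the first return to height 0,
-- so a word codes at most one tree.  Φ decodes: the word of P codes Φ P.
module Submission where

open import Defs using (MotzkinPath; LabelledBinaryTree; Φ; _≈_; _≈ᵗ_)
open import Data.Nat.Base using (ℕ; _<_)
open import Function.Structures using (IsBijection)

open import Defs hiding (MotzkinPath; LabelledBinaryTree; Φ; _≈_; _≈ᵗ_)
open import Data.Nat.Base using (zero; suc; z≤n; s≤s)
import Data.Nat.Base as ℕ
import Data.Nat.Properties as ℕₚ
open import Data.Nat.Induction using (Acc; acc; <-wellFounded)
open import Data.Integer.Base using (0ℤ; 1ℤ; -1ℤ; _+_)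
import Data.Integer.Base as ℤ
import Data.Integer.Properties as ℤₚ
open import Data.Fin.Base using (Fin; zero; suc; inject₁; opposite; punchOut; _↑ˡ_; _↑ʳ_)
import Data.Fin.Base as Fin
import Data.Fin.Properties as Finₚ
open import Data.Fin.Permutation using (Permutation′; permutation; _⟨$⟩ʳ_; ↔⇒≡)
open import Data.Fin.Subset using (Subset; inside; outside)
import Data.Vec.Base as Vec
open import Data.List.Base using (List; []; _∷_; _++_; _ʳ++_; length; map; tabulate; lookup)
import Data.List.Properties as Listₚ
open import Data.List.Membership.Propositional using () renaming (_∈_ to _∈ˡ_)
open import Data.List.Relation.Unary.All using ([]; _∷_)
import Data.List.Relation.Unary.All as All
import Data.List.Relation.Unary.All.Properties as Allₚ
open import Data.List.Relation.Unary.Any using (here; there)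
open import Data.List.Relation.Unary.AllPairs using ([]; _∷_)
open import Data.List.Relation.Unary.Unique.Propositional using (Unique)
open import Data.List.Relation.Binary.Disjoint.Propositional using (Disjoint)
open import Data.List.Relation.Binary.Permutation.Propositional using (_↭_; ↭-refl; ↭-sym; ↭-trans; ↭-prep; ↭⇒↭ₛ)
import Data.List.Relation.Binary.Permutation.Propositional.Properties as ↭ₚ
import Data.List.Relation.Binary.Permutation.Setoid.Properties as ↭ₛₚ
open import Data.List.Membership.Propositional.Properties using (∈-++⁺ʳ)
open import Data.Product.Base using (∃; ∃₂; _×_; _,_; proj₁; proj₂)
open import Data.Unit.Base using (⊤; tt)
open import Function.Base using (_∘_)
open import Function.Definitions using (Injective)
open import Relation.Nullary using (yes; no; contradiction)
open import Relation.Binary.Definitions using (tri<; tri≈; tri>)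
open import Relation.Binary.PropositionalEquality using (_≡_; _≗_; refl; sym; trans; cong; cong₂; subst; subst₂; setoid; module ≡-Reasoning)

private
  variable
    h m n : ℕ
    A : Set

-- Lists

Unique-++⁻ : ∀ (xs : List A) {ys} → Unique (xs ++ ys) → Unique xs × Unique ys × Disjoint xs ys
Unique-++⁻ []       ys!           = [] , ys! , λ { (() , _) }
Unique-++⁻ (x ∷ xs) (x∉ ∷ xs++ys!) with xs! , ys! , xs#ys ← Unique-++⁻ xs xs++ys! =
  Allₚ.++⁻ˡ xs x∉ ∷ xs! , ys! ,
  λ { (here refl , z∈ys) → All.lookup x∉ (∈-++⁺ʳ xs z∈ys) refl
    ; (there z∈xs , z∈ys) → xs#ys (z∈xs , z∈ys) }

ʳ++-cancel : ∀ (xs xs′ : List A) {ys ys′} → length xs ≡ length xs′ →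
             xs ʳ++ ys ≡ xs′ ʳ++ ys′ → xs ≡ xs′ × ys ≡ ys′
ʳ++-cancel []       []         _   eq = refl , eq
ʳ++-cancel (x ∷ xs) (x′ ∷ xs′) len eq
  with refl , eq′ ← ʳ++-cancel xs xs′ (ℕₚ.suc-injective len) eq
  with refl , eq″ ← Listₚ.∷-injective eq′ = refl , eq″

tabulate-surjective : (xs : List A) → length xs ≡ n → ∃ λ (f : Fin n → A) → tabulate f ≡ xs
tabulate-surjective xs refl = lookup xs , Listₚ.tabulate-lookup xs

tabulate-injective : {f g : Fin n → A} → tabulate f ≡ tabulate g → f ≗ g
tabulate-injective eq zero    = Listₚ.∷-injectiveˡ eq
tabulate-injective eq (suc i) = tabulate-injective (Listₚ.∷-injectiveʳ eq) i

tabulate-+ : ∀ m {l} (f : Fin (m ℕ.+ l) → A) →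
             tabulate f ≡ tabulate (λ i → f (i ↑ˡ l)) ++ tabulate (f ∘ (m ↑ʳ_))
tabulate-+ zero    f = refl
tabulate-+ (suc m) f = cong (f zero ∷_) (tabulate-+ m (f ∘ suc))

tabulate-∷ʳ : ∀ n (f : Fin (suc n) → A) {ys} →
              tabulate f ++ ys ≡ tabulate (f ∘ inject₁) ++ f (Fin.fromℕ n) ∷ ys
tabulate-∷ʳ zero    f = refl
tabulate-∷ʳ (suc n) f = cong (f zero ∷_) (tabulate-∷ʳ n (f ∘ suc))

-- The head `f (opposite zero)` is the last entry of `f`, and the reversal pushes it onto `ys`; what
-- remains is `f ∘ inject₁` reversed.
tabulate-opposite-ʳ++ : ∀ n (f : Fin n → A) {ys} → tabulate (f ∘ opposite) ʳ++ ys ≡ tabulate f ++ ys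
tabulate-opposite-ʳ++ zero    f = refl
tabulate-opposite-ʳ++ (suc n) f = trans (tabulate-opposite-ʳ++ n (f ∘ inject₁)) (sym (tabulate-∷ʳ n f))

Unique-tabulate⁻ : {f : Fin n → A} → Unique (tabulate f) → Injective _≡_ _≡_ f
Unique-tabulate⁻ (f₀∉ ∷ _) {zero}  {zero}  _  = refl
Unique-tabulate⁻ (f₀∉ ∷ _) {zero}  {suc j} eq = contradiction eq (Allₚ.tabulate⁻ f₀∉ j)
Unique-tabulate⁻ (f₀∉ ∷ _) {suc i} {zero}  eq = contradiction (sym eq) (Allₚ.tabulate⁻ f₀∉ i)
Unique-tabulate⁻ (_ ∷ f!)  {suc i} {suc j} eq = cong suc (Unique-tabulate⁻ f! eq)

Unique-resp-↭ : {xs ys : List A} → xs ↭ ys → Unique xs → Unique ys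
Unique-resp-↭ {A = A} xs↭ys = ↭ₛₚ.Unique-resp-↭ (setoid A) (↭⇒↭ₛ xs↭ys)

-- Pigeonhole: if `x` were missed, punching it out would inject `Fin (suc n)` into `Fin n`.
injective⇒preimage : {f : Fin n → Fin n} → Injective _≡_ _≡_ f → ∀ x → ∃ λ i → f i ≡ x
injective⇒preimage {suc n} {f} f-inj x with Finₚ.any? (λ i → f i Finₚ.≟ x)
... | yes found = found
... | no  none  = contradiction
  (λ {i} {j} eq → f-inj (Finₚ.punchOut-injective (avoids i) (avoids j) eq))
  (Finₚ.<⇒notInjective {f = λ i → punchOut (avoids i)} (ℕₚ.n<1+n n))
  where
  avoids = λ i x≡fi → none (i , sym x≡fi)

injective⇒permutation : (f : Fin n → Fin n) → Injective _≡_ _≡_ f → Permutation′ n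
injective⇒permutation f f-inj = permutation f (proj₁ ∘ pre) (proj₂ ∘ pre)
  (λ i → f-inj (proj₂ (pre (f i))))
  where pre = injective⇒preimage f-inj

-- Words of steps

-- In Motzkin h p and Bridge h q, h is the starting height; the final height
-- is -1 for Motzkin and 0 for Bridge.
data Motzkin : ℕ → List Step → Set where
  end   : Motzkin 0 (-1ₛ ∷ [])
  up    : ∀ {p} → Motzkin (suc h) p → Motzkin h (+1ₛ ∷ p)
  level : ∀ {p} → Motzkin h p → Motzkin h (0ₛ ∷ p)
  down  : ∀ {p} → Motzkin h p → Motzkin (suc h) (-1ₛ ∷ p)

data Bridge : ℕ → List Step → Set where
  end   : Bridge 0 []
  up    : ∀ {q} → Bridge (suc h) q → Bridge h (+1ₛ ∷ q)
  level : ∀ {q} → Bridge h q → Bridge h (0ₛ ∷ q)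
  down  : ∀ {q} → Bridge h q → Bridge (suc h) (-1ₛ ∷ q)

-- Each step of `p` moves, negated, to the front of the accumulator, which stays a bridge from the
-- current height; the final -1 of `p` becomes the leading +1. One `q′` serves for every
-- continuation `r`.
reverse-Motzkin : ∀ {p q} → Motzkin h p → Bridge h q →
                  ∃ λ q′ → Bridge 0 q′ × (∀ r → map neg p ʳ++ (q ++ r) ≡ +1ₛ ∷ q′ ++ r)
reverse-Motzkin end       b = _ , b , λ _ → refl
reverse-Motzkin (up c)    b = reverse-Motzkin c (down b)
reverse-Motzkin (level c) b = reverse-Motzkin c (level b)
reverse-Motzkin (down c)  b = reverse-Motzkin c (up b)

-- A bridge never goes below 0 and ends there, so the -1 after it is the first step to reach height
-- -1; the whole word determines its position.
first-passage-unique : ∀ {q q′ r r′} → Bridge h q → Bridge h q′ →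
                       q ++ -1ₛ ∷ r ≡ q′ ++ -1ₛ ∷ r′ → q ≡ q′ × r ≡ r′
first-passage-unique end       end        refl = refl , refl
first-passage-unique end       (up _)     ()
first-passage-unique end       (level _)  ()
first-passage-unique (up _)    end        ()
first-passage-unique (level _) end        ()
first-passage-unique (up b)    (up b′)    eq with refl , e ← first-passage-unique b b′ (Listₚ.∷-injectiveʳ eq) = refl , e
first-passage-unique (level b) (level b′) eq with refl , e ← first-passage-unique b b′ (Listₚ.∷-injectiveʳ eq) = refl , e
first-passage-unique (down b)  (down b′)  eq with refl , e ← first-passage-unique b b′ (Listₚ.∷-injectiveʳ eq) = refl , e
first-passage-unique (up _)    (level _)  ()
first-passage-unique (up _)    (down _)   ()
first-passage-unique (level _) (up _)     ()
first-passage-unique (level _) (down _)   ()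
first-passage-unique (down _)  (up _)     ()
first-passage-unique (down _)  (level _)  ()

-- Raised by one, the bridge stays at height at least 1 and ends at 1; the -1 then leads to 0, where
-- `r` starts.
Bridge-++ : ∀ {q r} → Bridge h q → Motzkin 0 r → Motzkin (suc h) (q ++ -1ₛ ∷ r)
Bridge-++ end       c = down c
Bridge-++ (up b)    c = up (Bridge-++ b c)
Bridge-++ (level b) c = level (Bridge-++ b c)
Bridge-++ (down b)  c = down (Bridge-++ b c)

glue-Motzkin : ∀ {p r} → Motzkin 0 p → Motzkin 0 r → Motzkin 0 (map neg p ʳ++ -1ₛ ∷ r)
glue-Motzkin {r = r} c d with _ , b , eq ← reverse-Motzkin c end =
  subst (Motzkin 0) (sym (eq (-1ₛ ∷ r))) (up (Bridge-++ b d))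

neg-injective : Injective _≡_ _≡_ neg
neg-injective { -1ₛ} { -1ₛ} _ = refl
neg-injective {0ₛ}   {0ₛ}   _ = refl
neg-injective {+1ₛ}  {+1ₛ}  _ = refl

glue-cancel : ∀ {p p′ r r′} → Motzkin 0 p → Motzkin 0 p′ →
              map neg p ʳ++ -1ₛ ∷ r ≡ map neg p′ ʳ++ -1ₛ ∷ r′ → p ≡ p′ × r ≡ r′
glue-cancel {p} {p′} {r} {r′} c c′ eq
  with _ , b , e ← reverse-Motzkin c end | _ , b′ , e′ ← reverse-Motzkin c′ end
  with refl , refl ← first-passage-unique b b′
         (Listₚ.∷-injectiveʳ (trans (sym (e (-1ₛ ∷ r))) (trans eq (e′ (-1ₛ ∷ r′)))))
  -- With the empty continuation, `e` and `e′` describe the reversed words alone, and these share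
  -- the same bridge.
  = Listₚ.map-injective neg-injective (Listₚ.reverse-injective (trans (e []) (sym (e′ [])))) , refl

-- Heights along words

height-up : ∀ h x → ℤ.+ h + (1ℤ + x) ≡ ℤ.+ suc h + x
height-up h x = trans (sym (ℤₚ.+-assoc (ℤ.+ h) 1ℤ x)) (cong (λ k → ℤ.+ k + x) (ℕₚ.+-comm h 1))

height-level : ∀ h x → ℤ.+ h + (0ℤ + x) ≡ ℤ.+ h + x
height-level h x = cong (λ y → ℤ.+ h + y) (ℤₚ.+-identityˡ x)

height-down : ∀ h x → ℤ.+ suc h + (-1ℤ + x) ≡ ℤ.+ h + x
height-down h x = sym (ℤₚ.+-assoc (ℤ.+ suc h) -1ℤ x)

-- The word is a variable with an equation because the constructors of `Motzkin` do not unify with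
-- `tabulate f`. The bound `j < n` excludes the final height -1.
height-nonneg : ∀ {p} (f : Fin n → Step) → tabulate f ≡ p → Motzkin h p →
                ∀ j → j < n → 0ℤ ℤ.≤ ℤ.+ h + height f j
height-nonneg _ _ _ zero _ = ℤ.+≤+ z≤n
height-nonneg {suc zero} f eq end (suc j) (s≤s ())
height-nonneg {suc _} {h} f eq (up c) (suc j) (s≤s j<n) with f zero | Listₚ.∷-injective eq
... | _ | refl , eq′ = subst (0ℤ ℤ.≤_) (sym (height-up h (height (f ∘ suc) j))) (height-nonneg (f ∘ suc) eq′ c j j<n)
height-nonneg {suc _} {h} f eq (level c) (suc j) (s≤s j<n) with f zero | Listₚ.∷-injective eq
... | _ | refl , eq′ = subst (0ℤ ℤ.≤_) (sym (height-level h (height (f ∘ suc) j))) (height-nonneg (f ∘ suc) eq′ c j j<n)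
height-nonneg {suc _} {suc h} f eq (down c) (suc j) (s≤s j<n) with f zero | Listₚ.∷-injective eq
... | _ | refl , eq′ = subst (0ℤ ℤ.≤_) (sym (height-down h (height (f ∘ suc) j))) (height-nonneg (f ∘ suc) eq′ c j j<n)

height-total : ∀ {p} (f : Fin n → Step) → tabulate f ≡ p → Motzkin h p → ℤ.+ h + height f n ≡ -1ℤ
height-total {suc zero} f eq end with f zero | Listₚ.∷-injective eq
... | _ | refl , _ = refl
height-total {suc n} {h} f eq (up c) with f zero | Listₚ.∷-injective eq
... | _ | refl , eq′ = trans (height-up h (height (f ∘ suc) n)) (height-total (f ∘ suc) eq′ c)
height-total {suc n} {h} f eq (level c) with f zero | Listₚ.∷-injective eq
... | _ | refl , eq′ = trans (height-level h (height (f ∘ suc) n)) (height-total (f ∘ suc) eq′ c)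
height-total {suc n} {suc h} f eq (down c) with f zero | Listₚ.∷-injective eq
... | _ | refl , eq′ = trans (height-down h (height (f ∘ suc) n)) (height-total (f ∘ suc) eq′ c)

-- Labelled words

Fits : Step → Fin n → Fin n → Set
Fits -1ₛ x y = x Fin.< y
Fits 0ₛ  x y = ⊤
Fits +1ₛ x y = y Fin.< x

Fits-neg : ∀ s {x y : Fin n} → Fits s x y → Fits (neg s) y x
Fits-neg -1ₛ x<y = x<y
Fits-neg 0ₛ  _   = tt
Fits-neg +1ₛ y<x = y<x

data WellLabelled {n} : List Step → List (Fin n) → Set where
  []  : ∀ {x} → WellLabelled [] (x ∷ [])
  _∷_ : ∀ {s p x y w} → Fits s x y → WellLabelled p (y ∷ w) → WellLabelled (s ∷ p) (x ∷ y ∷ w)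

WellLabelled-uncons : ∀ {p} {w : List (Fin n)} → WellLabelled p w → ∃₂ λ x w′ → w ≡ x ∷ w′
WellLabelled-uncons []      = _ , _ , refl
WellLabelled-uncons (_ ∷ _) = _ , _ , refl

WellLabelled-length : ∀ {p} {w : List (Fin n)} → WellLabelled p w → length w ≡ suc (length p)
WellLabelled-length []      = refl
WellLabelled-length (_ ∷ l) = cong suc (WellLabelled-length l)

-- The words share the label `x`. A step carried from one side of it to the other is traversed
-- backwards, which its negation compensates.
WellLabelled-ʳ++ : ∀ {p q x} {w v : List (Fin n)} → WellLabelled p (x ∷ w) → WellLabelled q (x ∷ v) →
                   WellLabelled (map neg p ʳ++ q) (w ʳ++ x ∷ v)
WellLabelled-ʳ++ []              k = k
WellLabelled-ʳ++ (_∷_ {s} fit l) k = WellLabelled-ʳ++ l (Fits-neg s fit ∷ k)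

WellLabelled-tabulate⁻ : (f : Fin m → Step) (g : Fin (suc m) → Fin n) →
                         WellLabelled (tabulate f) (tabulate g) →
                         ∀ i → Fits (f i) (g (inject₁ i)) (g (suc i))
WellLabelled-tabulate⁻ f g (fit ∷ _) zero = fit
WellLabelled-tabulate⁻ {m = suc (suc _)} f g (_ ∷ l) (suc i) = WellLabelled-tabulate⁻ (f ∘ suc) (g ∘ suc) l i

-- Coding of trees by words

-- The three clauses of Φ, with labels kept instead of renumbered. A single leaf has no code, so the
-- constructors apply to disjoint shapes of plane trees. In `glue`, `x` and `y` become the ends of
-- the inserted step.
data Codes {n} : BinTree (Fin n) → List Step → List (Fin n) → Set where
  cherry : ∀ {x y} → x Fin.< y → Codes (node (leaf x) (leaf y)) (-1ₛ ∷ []) (x ∷ y ∷ [])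
  graft  : ∀ {x t p w} → Codes t p w → Codes (node (leaf x) t) (0ₛ ∷ p) (x ∷ w)
  glue   : ∀ {t u p q x y w v} → Codes t p (x ∷ w) → Codes u q (y ∷ v) → x Fin.< y →
           Codes (node t u) (map neg p ʳ++ -1ₛ ∷ q) ((x ∷ w) ʳ++ y ∷ v)

Codes⇒Motzkin : ∀ {t : BinTree (Fin n)} {p w} → Codes t p w → Motzkin 0 p
Codes⇒Motzkin (cherry _)   = end
Codes⇒Motzkin (graft c)    = level (Codes⇒Motzkin c)
Codes⇒Motzkin (glue c d _) = glue-Motzkin (Codes⇒Motzkin c) (Codes⇒Motzkin d)

Codes⇒WellLabelled : ∀ {t : BinTree (Fin n)} {p w} → Codes t p w → WellLabelled p w
Codes⇒WellLabelled (cherry x<y) = x<y ∷ []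
Codes⇒WellLabelled (graft c) with l ← Codes⇒WellLabelled c with _ , _ , refl ← WellLabelled-uncons l = tt ∷ l
Codes⇒WellLabelled (glue c d x<y) = WellLabelled-ʳ++ (Codes⇒WellLabelled c) (x<y ∷ Codes⇒WellLabelled d)

Codes⇒↭ : ∀ {t : BinTree (Fin n)} {p w} → Codes t p w → w ↭ leaves t
Codes⇒↭ (cherry _) = ↭-refl
Codes⇒↭ (graft c)  = ↭-prep _ (Codes⇒↭ c)
Codes⇒↭ (glue {x = x} {w = w} c d _) =
  ↭-trans (↭-sym (↭ₚ.++↭ʳ++ (x ∷ w) _)) (↭ₚ.++⁺ (Codes⇒↭ c) (Codes⇒↭ d))

Codes-relabel : ∀ {f : Fin m → Fin n} {t p w} → (∀ {i j} → i Fin.< j → f i Fin.< f j) →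
                Codes t p w → Codes (relabel f t) p (map f w)
Codes-relabel mono (cherry x<y) = cherry (mono x<y)
Codes-relabel mono (graft c)    = graft (Codes-relabel mono c)
Codes-relabel {f = f} mono (glue {x = x} {w = w} c d x<y) =
  subst (Codes _ _) (sym (Listₚ.map-ʳ++ f (x ∷ w)))
    (glue (Codes-relabel mono c) (Codes-relabel mono d) (mono x<y))

-- Which children are leaves decides the constructor. Exchanging the children of a `cherry` or a
-- `glue` would require both `x < y` and `y < x`.
Codes-functional : ∀ {t t′ : BinTree (Fin n)} {p p′ w w′} → t ≅ t′ →
                   Codes t p w → Codes t′ p′ w′ → p ≡ p′ × w ≡ w′
Codes-functional (node leaf leaf) (cherry _)   (cherry _)   = refl , refl
Codes-functional (swap leaf leaf) (cherry x<y) (cherry y<x) = contradiction y<x (Finₚ.<-asym x<y)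
Codes-functional (node leaf e)    (graft c)    (graft c′)
  with refl , refl ← Codes-functional e c c′ = refl , refl
Codes-functional (node e f) (glue c d _) (glue c′ d′ _)
  with refl , refl ← Codes-functional e c c′ | refl , refl ← Codes-functional f d d′ = refl , refl
Codes-functional (swap e f) (glue c d x<y) (glue c′ d′ y<x)
  with refl , refl ← Codes-functional e c d′ | refl , refl ← Codes-functional f d c′ =
  contradiction y<x (Finₚ.<-asym x<y)
Codes-functional (node leaf leaf) (cherry _) (graft ())
Codes-functional (swap leaf leaf) (cherry _) (graft ())
Codes-functional (node leaf leaf) (cherry _) (glue () _ _)
Codes-functional (swap leaf leaf) (cherry _) (glue () _ _)
Codes-functional (node leaf leaf) (graft ()) (cherry _)
Codes-functional (swap leaf leaf) (graft ()) (cherry _)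
Codes-functional (swap leaf leaf) (graft ()) (graft _)
Codes-functional (node leaf _)    (graft _)  (glue () _ _)
Codes-functional (swap leaf _)    (graft _)  (glue _ () _)
Codes-functional (node leaf _)    (glue () _ _) (cherry _)
Codes-functional (swap leaf _)    (glue () _ _) (cherry _)
Codes-functional (node leaf _)    (glue () _ _) (graft _)
Codes-functional (swap _ leaf)    (glue _ () _) (graft _)

-- Separates `glue` from `cherry` and `graft`, whose words start with -1 and 0.
glue-starts-up : ∀ {p q s r} → Motzkin 0 p → map neg p ʳ++ -1ₛ ∷ q ≡ s ∷ r → s ≡ +1ₛ
glue-starts-up {q = q} c eq with _ , _ , e ← reverse-Motzkin c end =
  Listₚ.∷-injectiveˡ (trans (sym eq) (e (-1ₛ ∷ q)))

Codes-injective : ∀ {t t′ : BinTree (Fin n)} {p p′ w w′} →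
                  Codes t p w → Codes t′ p′ w′ → p ≡ p′ → w ≡ w′ → t ≡ t′
Codes-injective (cherry _) (cherry _) _ refl = refl
Codes-injective (graft c) (graft c′) p≡ w≡
  with refl , w≡′ ← Listₚ.∷-injective w≡ =
  cong (node _) (Codes-injective c c′ (Listₚ.∷-injectiveʳ p≡) w≡′)
Codes-injective (glue {w = w} c d _) (glue {w = w′} c′ d′ _) p≡ w≡
  with refl , refl ← glue-cancel (Codes⇒Motzkin c) (Codes⇒Motzkin c′) p≡
  -- Equal step words force label words of equal length, so both glued label words are cut at the
  -- same place.
  with refl , refl ← ʳ++-cancel (_ ∷ w) (_ ∷ w′)
         (trans (WellLabelled-length (Codes⇒WellLabelled c)) (sym (WellLabelled-length (Codes⇒WellLabelled c′)))) w≡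
  = cong₂ node (Codes-injective c c′ refl refl) (Codes-injective d d′ refl refl)
Codes-injective (cherry _) (graft _) ()
Codes-injective (graft _) (cherry _) ()
Codes-injective (cherry _) (glue c _ _) p≡ _ with () ← glue-starts-up (Codes⇒Motzkin c) (sym p≡)
Codes-injective (graft _) (glue c _ _) p≡ _ with () ← glue-starts-up (Codes⇒Motzkin c) (sym p≡)
Codes-injective (glue c _ _) (cherry _) p≡ _ with () ← glue-starts-up (Codes⇒Motzkin c) p≡
Codes-injective (glue c _ _) (graft _) p≡ _ with () ← glue-starts-up (Codes⇒Motzkin c) p≡

-- Existence of codes

≅⇒↭ : {t u : BinTree A} → t ≅ u → leaves t ↭ leaves u
≅⇒↭ leaf       = ↭-refl
≅⇒↭ (node e f) = ↭ₚ.++⁺ (≅⇒↭ e) (≅⇒↭ f)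
≅⇒↭ (swap {t} {u} e f) = ↭-trans (↭ₚ.++-comm (leaves t) (leaves u)) (↭ₚ.++⁺ (≅⇒↭ f) (≅⇒↭ e))

-- The tree is coded up to exchanging children. The label word is split at its head so that the
-- first labels of two codes can be compared.
record Coded {n} (t : BinTree (Fin n)) : Set where
  constructor coded
  field
    {tree′} : BinTree (Fin n)
    {steps} : List Step
    {first} : Fin n
    {rest}  : List (Fin n)
    iso     : t ≅ tree′
    codes   : Codes tree′ steps (first ∷ rest)

  first-∈ : first ∈ˡ leaves t
  first-∈ = ↭ₚ.∈-resp-↭ (↭-trans (Codes⇒↭ codes) (↭-sym (≅⇒↭ iso))) (here refl)

mkCoded : ∀ {t t′ : BinTree (Fin n)} {p w} → t ≅ t′ → Codes t′ p w → Coded t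
mkCoded e c with _ , _ , refl ← WellLabelled-uncons (Codes⇒WellLabelled c) = coded e c

-- Takes the two children, since only internal vertices have codes. A lone leaf goes before a larger
-- subtree; otherwise the child with the smaller first label goes first.
code : ∀ (t u : BinTree (Fin n)) → Unique (leaves (node t u)) → Coded (node t u)
code (leaf x) (leaf y) ((x≢y ∷ _) ∷ _) with Finₚ.<-cmp x y
... | tri< x<y _ _ = coded ≅-refl (cherry x<y)
... | tri≈ _ x≡y _ = contradiction x≡y x≢y
... | tri> _ _ y<x = coded (swap leaf leaf) (cherry y<x)
code (leaf x) (node u u′) (_ ∷ u!) with coded e c ← code u u′ u! = coded (node leaf e) (graft c)
code (node t t′) (leaf x) tx!
  with t! , _ ← Unique-++⁻ (leaves (node t t′)) tx!
  with coded e c ← code t t′ t! = coded (swap e leaf) (graft c)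
code (node t t′) (node u u′) tu!
  with t! , u! , t#u ← Unique-++⁻ (leaves (node t t′)) tu!
  with T ← code t t′ t! | U ← code u u′ u!
  with Finₚ.<-cmp (Coded.first T) (Coded.first U)
... | tri< x<y _ _ = mkCoded (node (Coded.iso T) (Coded.iso U)) (glue (Coded.codes T) (Coded.codes U) x<y)
-- Equal first labels would be a leaf label common to both children.
... | tri≈ _ x≡y _ = contradiction (Coded.first-∈ T , subst (_∈ˡ _) (sym x≡y) (Coded.first-∈ U)) t#u
... | tri> _ _ y<x = mkCoded (swap (Coded.iso T) (Coded.iso U)) (glue (Coded.codes U) (Coded.codes T) y<x)

-- Paths and their words

steps : MotzkinPath n → List Step
steps P = tabulate (MotzkinPath.p P)

labels : MotzkinPath n → List (Fin n)
labels P = tabulate (MotzkinPath.σ P ⟨$⟩ʳ_)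

words⇒≈ : {P Q : MotzkinPath n} → steps P ≡ steps Q → labels P ≡ labels Q → P ≈ Q
words⇒≈ e f = tabulate-injective e , tabulate-injective f

toPath : ∀ {p} {w : List (Fin (2 ℕ.+ m))} → Motzkin 0 p → WellLabelled p w → Unique w →
         length w ≡ 2 ℕ.+ m → ∃ λ P → steps P ≡ p × labels P ≡ w
toPath {m} {p} {w} c l w! len
  with f , refl ← tabulate-surjective {n = suc m} p (ℕₚ.suc-injective (trans (sym (WellLabelled-length l)) len))
     | g , refl ← tabulate-surjective w len
  = record
    { path   = record
      { p       = f
      ; σ       = injective⇒permutation g (Unique-tabulate⁻ w!)
      -- Once the step is replaced along `e`, `Fits` computes to the required inequality, here and
      -- for descents.
      ; ascent  = λ i e → subst (λ s → Fits s (g (source i)) (g (target i))) e (WellLabelled-tabulate⁻ f g l i)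
      ; descent = λ i e → subst (λ s → Fits s (g (source i)) (g (target i))) e (WellLabelled-tabulate⁻ f g l i)
      }
    ; nonneg = λ j _ j≤m → subst (0ℤ ℤ.≤_) (ℤₚ.+-identityˡ _) (height-nonneg f refl c j (s≤s j≤m))
    ; total  = trans (sym (ℤₚ.+-identityˡ _)) (height-total f refl c)
    } , refl , refl

-- Φ decodes words

λ-mono : (I : Subset n) {i j : Fin _} → i Fin.< j → λ⟨ I ⟩ i Fin.< λ⟨ I ⟩ j
λ-mono (inside  Vec.∷ I) {zero}  {suc j} _         = s≤s z≤n
λ-mono (inside  Vec.∷ I) {suc i} {suc j} (s≤s i<j) = s≤s (λ-mono I i<j)
λ-mono (outside Vec.∷ I)                 i<j       = s≤s (λ-mono I i<j)

module _ {f : Fin m → Fin n} {I : Subset n} (L : f Lists I) where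
  open Listing L

  embed-mono : ∀ {i j} → i Fin.< j → embed i Fin.< embed j
  embed-mono i<j = λ-mono I (subst₂ _<_ (sym (Finₚ.toℕ-cast _ _)) (sym (Finₚ.toℕ-cast _ _)) i<j)

  embed-standardise : ∀ i → embed (standardise ⟨$⟩ʳ i) ≡ f i
  embed-standardise i = trans (cong λ⟨ I ⟩ (Finₚ.cast-involutive (↔⇒≡ ranks) (sym (↔⇒≡ ranks)) _)) (λ-λ⁻¹ I (_Lists_.member L i))

  -- `embed` undoes the renumbering made by `standardise`, so the code of a smaller path becomes a
  -- code with the labels of the original word.
  Codes-embed : ∀ {t p} → Codes t p (tabulate (standardise ⟨$⟩ʳ_)) → Codes (relabel embed t) p (tabulate f)
  Codes-embed c = subst (Codes _ _)
    (trans (Listₚ.map-tabulate _ embed) (Listₚ.tabulate-cong embed-standardise))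
    (Codes-relabel embed-mono c)

-- Induction along the recursion of Φ: its three cases produce `cherry`, `graft` and `glue`.
Φ-rec-codes : (ac : Acc _<_ n) {P : MotzkinPath n} (v : View P) →
              Codes (LabelledBinaryTree.tree (Φ-rec ac v)) (steps P) (labels P)
Φ-rec-codes _ (size-2 P) = subst₂ (Codes _) (cong (_∷ []) (sym p₁≡-1)) (sym (sorted (ascent zero p₁≡-1))) (cherry (s≤s z≤n))
  where
  open MotzkinPath P
  last : ∀ s → ⟦ s ⟧ + 0ℤ ≡ -1ℤ → s ≡ -1ₛ
  last -1ₛ _ = refl
  p₁≡-1 : p zero ≡ -1ₛ
  p₁≡-1 = last (p zero) total
  sorted : ∀ {x y : Fin 2} → x Fin.< y → x ∷ y ∷ [] ≡ zero ∷ suc zero ∷ []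
  sorted {zero} {suc zero} _ = refl
  sorted {suc zero} {suc zero} (s≤s ())
Φ-rec-codes (acc rec) (start-0 P p₁≡0) =
  -- Both words of `P` unfold to a head and a tail by computation; only the first step has to be
  -- rewritten to 0.
  subst (λ s → Codes (LabelledBinaryTree.tree (Φ-rec (acc rec) (start-0 P p₁≡0))) (s ∷ steps smaller) (labels P))
    (sym p₁≡0) (graft (Codes-embed listing (Φ-rec-codes (rec (ℕₚ.n<1+n _)) (view smaller))))
  where open Start-0 P p₁≡0
Φ-rec-codes (acc rec) (start-1 a b P _ isFirstReturn) =
  subst₂ (Codes _) steps≡ labels≡
    (glue (Codes-embed listing′ (Φ-rec-codes (rec (ℕₚ.m<m+n k (s≤s z≤n))) (view smaller′)))
          (Codes-embed listing″ (Φ-rec-codes (rec (ℕₚ.m<n+m l {k} (s≤s z≤n))) (view smaller″)))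
          first<first)
  where
  open MotzkinPath P
  open IsFirstReturn isFirstReturn
  open Start-1 a b P isFirstReturn

  neg-involutive : ∀ s → neg (neg s) ≡ s
  neg-involutive -1ₛ = refl
  neg-involutive 0ₛ  = refl
  neg-involutive +1ₛ = refl

  returning : ∀ s → 1ℤ + ⟦ s ⟧ ≡ 0ℤ → s ≡ -1ₛ
  returning -1ₛ _ = refl

  -- The height just before the first return is 1, which leaves only a down step.
  pₖ≡-1 : p iₖ ≡ -1ₛ
  pₖ≡-1 = returning (p iₖ) (begin
    1ℤ + ⟦ p iₖ ⟧                ≡⟨ cong (_+ ⟦ p iₖ ⟧) before-return ⟨
    height p (suc a) + ⟦ p iₖ ⟧  ≡⟨ subst (λ x → height p (suc x) ≡ height p x + ⟦ p iₖ ⟧) toℕ-iₖ (height-suc p iₖ) ⟨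
    height p k                   ≡⟨ return ⟩
    0ℤ                           ∎)
    where open ≡-Reasoning

  opposite-zero : ∀ a → inject₁ (suc a ↑ʳ zero {suc b}) ≡ opposite (zero {suc a}) ↑ˡ l
  opposite-zero zero    = refl
  opposite-zero (suc a) = cong suc (opposite-zero a)

  -- Step k joins the last prefix label, which comes first after reversal, to the first suffix
  -- label. Being -1, it is an ascent, as `glue` requires.
  first<first : prefix (opposite zero) Fin.< suffix zero
  first<first = subst (λ i → σ ⟨$⟩ʳ i Fin.< suffix zero) (opposite-zero a) (ascent iₖ pₖ≡-1)

  steps≡ : map neg (tabulate p′) ʳ++ -1ₛ ∷ tabulate p″ ≡ tabulate p
  steps≡ = begin
    map neg (tabulate p′) ʳ++ -1ₛ ∷ tabulate p″
      -- `p′` is already reversed and negated, so gluing restores the original steps.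
      ≡⟨ cong (_ʳ++ -1ₛ ∷ tabulate p″) (trans (Listₚ.map-tabulate p′ neg) (Listₚ.tabulate-cong λ i → neg-involutive (p (opposite i ↑ˡ l)))) ⟩
    tabulate {n = suc a} (λ i → p (opposite i ↑ˡ l)) ʳ++ -1ₛ ∷ tabulate p″
      ≡⟨ tabulate-opposite-ʳ++ (suc a) (λ i → p (i ↑ˡ l)) ⟩
    tabulate {n = suc a} (λ i → p (i ↑ˡ l)) ++ -1ₛ ∷ tabulate p″
      ≡⟨ cong (λ s → tabulate {n = suc a} (λ i → p (i ↑ˡ l)) ++ s ∷ tabulate p″) pₖ≡-1 ⟨
    tabulate {n = suc a} (λ i → p (i ↑ˡ l)) ++ tabulate (p ∘ (suc a ↑ʳ_))
      ≡⟨ tabulate-+ (suc a) p ⟨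
    tabulate p
      ∎
    where open ≡-Reasoning

  labels≡ : tabulate (prefix ∘ opposite) ʳ++ tabulate suffix ≡ labels P
  labels≡ = trans (tabulate-opposite-ʳ++ k prefix) (sym (tabulate-+ k (σ ⟨$⟩ʳ_)))

Φ-codes : (1<n : 1 < n) (P : MotzkinPath n) →
          Codes (LabelledBinaryTree.tree (Φ 1<n P)) (steps P) (labels P)
Φ-codes (s≤s (s≤s _)) P = Φ-rec-codes (<-wellFounded _) (view P)

-- Bijectivity of Φ

module _ (1<n : 1 < n) where

  -- Equivalent paths have equal words, and one word codes a single plane tree; the two images are
  -- therefore equal, not merely isomorphic.
  Φ-cong : {P Q : MotzkinPath n} → P ≈ Q → Φ 1<n P ≈ᵗ Φ 1<n Q
  Φ-cong {P} {Q} (p≗ , σ≗) = subst (_ ≅_)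
    (Codes-injective (Φ-codes 1<n P) (Φ-codes 1<n Q) (Listₚ.tabulate-cong p≗) (Listₚ.tabulate-cong σ≗)) ≅-refl

  Φ-injective : {P Q : MotzkinPath n} → Φ 1<n P ≈ᵗ Φ 1<n Q → P ≈ Q
  Φ-injective {P} {Q} e with e₁ , e₂ ← Codes-functional e (Φ-codes 1<n P) (Φ-codes 1<n Q) = words⇒≈ {P = P} {Q} e₁ e₂

Φ-surjective : (1<n : 1 < 2 ℕ.+ m) (τ : LabelledBinaryTree (2 ℕ.+ m)) → ∃ λ P → Φ 1<n P ≈ᵗ τ
Φ-surjective _   record { tree = leaf _ ; isLabelled = record { size = () } }
Φ-surjective 1<n record { tree = node t u ; isLabelled = record { size = size ; distinct = t! } }
  with coded iso c ← code t u t!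
  with w↭ ← ↭-trans (Codes⇒↭ c) (↭-sym (≅⇒↭ iso))
  with P , refl , e ← toPath (Codes⇒Motzkin c) (Codes⇒WellLabelled c)
                        (Unique-resp-↭ (↭-sym w↭) t!) (trans (↭ₚ.↭-length w↭) size)
  -- The word of `P` codes both `Φ 1<n P` and the rearranged tree found by `code`, so these are
  -- equal.
  = P , subst (_≅ _) (sym (Codes-injective (Φ-codes 1<n P) c refl e)) (≅-sym iso)

theorem1 : ∀ (n : ℕ) (1<n : 1 < n) → IsBijection (_≈_ {n}) (_≈ᵗ_ {n}) (Φ 1<n)
theorem1 (suc (suc m)) 1<n = record
  { isInjection = record
    { isCongruent = record
      { cong           = λ {P} {Q} → Φ-cong 1<n {P} {Q}
      ; isEquivalence₁ = ≈-isEquivalence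
      ; isEquivalence₂ = ≈ᵗ-isEquivalence
      }
    ; injective = λ {P} {Q} → Φ-injective 1<n {P} {Q}
    }
  ; surjective = λ τ → let P , e = Φ-surjective 1<n τ in
      -- Setoid surjectivity concerns every path equivalent to the chosen preimage, hence the appeal
      -- to congruence.
      P , λ {Q} Q≈P → ≅-trans (Φ-cong 1<n {Q} {P} Q≈P) e
  }
theorem1 (suc zero) (s≤s ())
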